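{- Let $G$ and $H$ be finite simple connected graphs that are not complete graphs. Then the graph $G\boxtimes H$ has no extreme vertices (with respect to toll convexity).
   Context: The strong product $G\boxtimes H$ has vertex set $V(G)\times V(H)$; $(g_1,h_1)$ and $(g_2,h_2)$ are adjacent iff ($g_1g_2\in E(G)$ and $h_1=h_2$) or ($g_1=g_2$ and $h_1h_2\in E(H)$) or ($g_1g_2\in E(G)$ and $h_1h_2\in E(H)$). For two different non-adjacent vertices $u,v$ of a graph $F$, a tolled walk between $u$ and $v$ is a sequence of vertices $u,w_1,\dots,w_k,v$ with $k\ge 1$ such that consecutive vertices of $w_1,\dots,w_k$ are adjacent, $uw_i\in E(F)$ if and only if $i=1$, and $vw_i\in E(F)$ if and only if $i=k$. If $uv\in E(F)$, the only tolled walk between $u$ and $v$ is $u,v$; the only tolled walk from $v$ to itself is the single vertex $v$. The toll interval $T_F(u,v)$ is the set of all vertices of $F$ lying on some tolled walk between $u$ and $v$. A set $S\subseteq V(F)$ is toll convex if $T_F(u,v)\subseteq S$ for all $u,v\in S$. A vertex $s$ is an extreme vertex of $F$ if $V(F)\setminus\{s\}$ is toll convex. -}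

module Defs where

open import Data.Fin using (Fin; zero; suc; inject₁; fromℕ)
open import Data.List using (List; []; _∷_; [_]; _++_)
open import Data.List.Membership.Propositional using (_∈_)
open import Data.Nat using (ℕ; suc)
open import Data.Product using (∃-syntax; _×_; _,_)
open import Data.Sum using (_⊎_; inj₁; inj₂)
open import Data.Vec.Functional using (Vector; toList)
open import Function.Bundles using (_⇔_; _↔_)
open import Level using (0ℓ)
open import Relation.Binary.Construct.Closure.ReflexiveTransitive using (Star)
open import Relation.Binary.Core using (Rel)
open import Relation.Binary.Definitions using (Symmetric; Irreflexive)
open import Relation.Binary.PropositionalEquality using (_≡_; _≢_; refl; sym)
open import Relation.Nullary using (¬_)
open import Relation.Unary using (Pred; _⊆_; ∁; ｛_｝)

-- Adjacency is not assumed decidable.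
record Graph : Set₁ where
  field
    V          : Set
    Adj        : Rel V 0ℓ
    adj-sym    : Symmetric Adj
    adj-irrefl : Irreflexive _≡_ Adj

open Graph public

Finite : Graph → Set
Finite G = ∃[ n ] (V G ↔ Fin n)

Connected : Graph → Set
Connected G = ∀ u v → Star (Adj G) u v

Complete : Graph → Set
Complete G = ∀ {u v} → u ≢ v → Adj G u v

infixr 7 _⊠_

_⊠_ : Graph → Graph → Graph
G ⊠ H = record
  { V          = V G × V H
  ; Adj        = _~_
  ; adj-sym    = ~-sym
  ; adj-irrefl = ~-irrefl
  }
  where
  _~_ : Rel (V G × V H) 0ℓ
  (g₁ , h₁) ~ (g₂ , h₂) =
      (Adj G g₁ g₂ × h₁ ≡ h₂)
    ⊎ (g₁ ≡ g₂ × Adj H h₁ h₂)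
    ⊎ (Adj G g₁ g₂ × Adj H h₁ h₂)

  ~-sym : Symmetric _~_
  ~-sym (inj₁ (a , e))        = inj₁ (adj-sym G a , sym e)
  ~-sym (inj₂ (inj₁ (e , b))) = inj₂ (inj₁ (sym e , adj-sym H b))
  ~-sym (inj₂ (inj₂ (a , b))) = inj₂ (inj₂ (adj-sym G a , adj-sym H b))

  ~-irrefl : Irreflexive _≡_ _~_
  ~-irrefl refl (inj₁ (a , _))        = adj-irrefl G refl a
  ~-irrefl refl (inj₂ (inj₁ (_ , b))) = adj-irrefl H refl b
  ~-irrefl refl (inj₂ (inj₂ (a , _))) = adj-irrefl G refl a

-- The index is the full vertex sequence, both ends included.  In the `walk`
-- case there are suc k interior vertices, so that there is at least one;
-- w zero is the first of them and w (fromℕ k) the last.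
data TolledWalk (F : Graph) : (u v : V F) → List (V F) → Set where
  point : ∀ {v} → TolledWalk F v v [ v ]
  edge  : ∀ {u v} → Adj F u v → TolledWalk F u v (u ∷ v ∷ [])
  walk  : ∀ {u v k} (w : Vector (V F) (suc k)) →
          u ≢ v → ¬ Adj F u v →
          (∀ (i : Fin k) → Adj F (w (inject₁ i)) (w (suc i))) →
          (∀ i → Adj F u (w i) ⇔ i ≡ zero) →
          (∀ i → Adj F v (w i) ⇔ i ≡ fromℕ k) →
          TolledWalk F u v (u ∷ toList w ++ [ v ])

TollInterval : (F : Graph) → V F → V F → Pred (V F) 0ℓ
TollInterval F u v x = ∃[ ws ] (TolledWalk F u v ws × x ∈ ws)

TollConvex : (F : Graph) → Pred (V F) 0ℓ → Set
TollConvex F S = ∀ {u v} → S u → S v → TollInterval F u v ⊆ S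

Extreme : (F : Graph) → Pred (V F) 0ℓ
Extreme F s = TollConvex F (∁ ｛ s ｝)

{-# OPTIONS --safe #-}
-- Fix s = (g , h).  A vertex g of a connected non-complete graph is the midpoint or an
-- end of an induced path on three vertices: otherwise g is joined to all other vertices
-- and these are pairwise adjacent.  If g or h is a midpoint, so is s in its layer, and
-- an induced path is a tolled walk.  If g g₁ g₂ and h h₁ h₂ are induced paths, then
--   (g₂ , h) (g₁ , h) (g , h) (g , h₁) (g , h₂)
-- is a tolled walk through s.
-- As adjacency is not decidable, the dichotomy is only obtained up to double negation;
-- finiteness allows the double negation to be moved out of the quantifiers over vertices.
module Submission where

open import Defs
open import Data.Fin using (Fin; zero; suc)
open import Data.Fin.Properties using (sequence)
open import Data.List.Relation.Unary.Any using (here; there)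
open import Data.Product using (∃-syntax; _×_; _,_; proj₁; proj₂)
open import Data.Product.Properties using (,-injectiveˡ; ,-injectiveʳ)
open import Data.Sum using (_⊎_; inj₁; inj₂)
open import Data.Vec.Functional using (Vector; []; _∷_)
open import Effect.Monad using (RawMonad)
open import Function using (_∘_)
open import Function.Bundles using (Inverse; mk⇔)
open import Level using (0ℓ)
open import Relation.Binary.Construct.Closure.ReflexiveTransitive using (Star; ε; _◅_)
open import Relation.Binary.PropositionalEquality using (_≡_; _≢_; refl; subst; ≢-sym)
open import Relation.Nullary using (¬_; contradiction)
open import Relation.Nullary.Negation using (¬¬-Monad)
open import Relation.Unary using (Pred)

Apart : (F : Graph) → V F → V F → Set
Apart F u v = u ≢ v × ¬ Adj F u v

Apart-sym : (F : Graph) → ∀ {u v} → Apart F u v → Apart F v u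
Apart-sym F (u≢v , u≁v) = ≢-sym u≢v , u≁v ∘ adj-sym F

InducedP₃ : (F : Graph) → V F → V F → V F → Set
InducedP₃ F x y z = Adj F x y × Adj F y z × Apart F x z

Midpoint End : (F : Graph) → Pred (V F) 0ℓ
Midpoint F y = ∃[ x ] ∃[ z ] InducedP₃ F x y z
End      F x = ∃[ y ] ∃[ z ] InducedP₃ F x y z

-- Over `Fin n` this is `sequence` in the double-negation applicative. The bijection carries it to
-- `V F`, with `subst` because `from (to v)` equals `v` only propositionally.
¬¬-∀ : (F : Graph) → Finite F → {P : Pred (V F) 0ℓ} →
       (∀ v → ¬ ¬ P v) → ¬ ¬ (∀ v → P v)
¬¬-∀ F (n , V↔Fin) {P} p ¬∀ =
  sequence (RawMonad.rawApplicative ¬¬-Monad) (p ∘ from)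
    λ q → ¬∀ λ v → subst P (strictlyInverseʳ v) (q (to v))
  where open Inverse V↔Fin

module _ (F : Graph) (g : V F) (¬mid : ¬ Midpoint F g) (¬end : ¬ End F g) where

  -- Induction along the walk: if `w` were neither `g` nor a neighbour of `g`, then `u` could not be
  -- `g`, so `g`, `u`, `w` would be an induced path with end `g`.
  reachable⇒dominated : ∀ {u v} → Star (Adj F) u v →
                        ¬ ¬ (g ≡ u ⊎ Adj F g u) → ¬ ¬ (g ≡ v ⊎ Adj F g v)
  reachable⇒dominated ε          p = p
  reachable⇒dominated (u~w ◅ ws) p = reachable⇒dominated ws λ w∉ → p λ where
    (inj₁ refl) → w∉ (inj₂ u~w)
    (inj₂ g~u)  → ¬end (_ , _ , g~u , u~w , w∉ ∘ inj₁ , w∉ ∘ inj₂)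

  module _ (conn : Connected F) where

    -- If one of the two vertices is `g`, domination of the other gives adjacency; two distinct
    -- non-adjacent neighbours of `g` would make `g` a midpoint.
    ¬¬-adjacent : ∀ u v → u ≢ v → ¬ ¬ Adj F u v
    ¬¬-adjacent u v u≢v u≁v =
      dominated u λ where
        (inj₁ refl) → dominated v λ where
          (inj₁ g≡v) → u≢v g≡v
          (inj₂ g~v) → u≁v g~v
        (inj₂ g~u)  → dominated v λ where
          (inj₁ refl) → u≁v (adj-sym F g~u)
          (inj₂ g~v)  → ¬mid (_ , _ , adj-sym F g~u , g~v , u≢v , u≁v)
      where
      dominated : ∀ v → ¬ ¬ (g ≡ v ⊎ Adj F g v)
      dominated v = reachable⇒dominated (conn g v) λ ¬p → ¬p (inj₁ refl)

    ¬¬-complete : Finite F → ¬ ¬ Complete F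
    ¬¬-complete fin ¬comp =
      ¬¬-∀ F fin (λ u → ¬¬-∀ F fin λ v ¬p →
          -- Pulls the double negation out of the implication without deciding whether `u` equals
          -- `v`: adjacency alone would already contradict `¬p`.
          ¬p λ u≢v → contradiction (λ u~v → ¬p λ _ → u~v) (¬¬-adjacent u v u≢v))
        λ adj → ¬comp λ {u} {v} → adj u v

¬¬-midpoint⊎end : (F : Graph) → Finite F → Connected F → ¬ Complete F →
                  ∀ g → ¬ ¬ (Midpoint F g ⊎ End F g)
¬¬-midpoint⊎end F fin conn ¬comp g ¬p =
  ¬¬-complete F g (¬p ∘ inj₁) (¬p ∘ inj₂) conn fin ¬comp

adj⇒≢ : (F : Graph) → ∀ {u v} → Adj F u v → u ≢ v
adj⇒≢ F u~v u≡v = adj-irrefl F u≡v u~v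

midpoint⇒¬extreme : (F : Graph) → ∀ {s} → Midpoint F s → ¬ Extreme F s
midpoint⇒¬extreme F {s} (u , v , u~s , s~v , u≢v , u≁v) ext =
  ext (≢-sym (adj⇒≢ F u~s)) (adj⇒≢ F s~v)
    -- The only interior vertex is both first and last, so the toll conditions reduce to `s` being
    -- adjacent to both ends.
    (_ , walk (s ∷ []) u≢v u≁v (λ ())
           (λ { zero → mk⇔ (λ _ → refl) (λ _ → u~s) })
           (λ { zero → mk⇔ (λ _ → refl) (λ _ → adj-sym F s~v) })
       , there (here refl))
    refl

module _ (G H : Graph) where

  -- Adjacent vertices of the strong product have equal or adjacent coordinates, so one pair of
  -- apart coordinates suffices, whatever the other pair is.
  apartˡ : ∀ {g₁ g₂ h₁ h₂} → Apart G g₁ g₂ → Apart (G ⊠ H) (g₁ , h₁) (g₂ , h₂)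
  apartˡ (g₁≢g₂ , g₁≁g₂) = g₁≢g₂ ∘ ,-injectiveˡ , λ where
    (inj₁ (g₁~g₂ , _))        → g₁≁g₂ g₁~g₂
    (inj₂ (inj₁ (g₁≡g₂ , _))) → g₁≢g₂ g₁≡g₂
    (inj₂ (inj₂ (g₁~g₂ , _))) → g₁≁g₂ g₁~g₂

  apartʳ : ∀ {g₁ g₂ h₁ h₂} → Apart H h₁ h₂ → Apart (G ⊠ H) (g₁ , h₁) (g₂ , h₂)
  apartʳ (h₁≢h₂ , h₁≁h₂) = h₁≢h₂ ∘ ,-injectiveʳ , λ where
    (inj₁ (_ , h₁≡h₂))        → h₁≢h₂ h₁≡h₂
    (inj₂ (inj₁ (_ , h₁~h₂))) → h₁≁h₂ h₁~h₂
    (inj₂ (inj₂ (_ , h₁~h₂))) → h₁≁h₂ h₁~h₂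

  adjˡ : ∀ {g₁ g₂ h} → Adj G g₁ g₂ → Adj (G ⊠ H) (g₁ , h) (g₂ , h)
  adjˡ g₁~g₂ = inj₁ (g₁~g₂ , refl)

  adjʳ : ∀ {g h₁ h₂} → Adj H h₁ h₂ → Adj (G ⊠ H) (g , h₁) (g , h₂)
  adjʳ h₁~h₂ = inj₂ (inj₁ (refl , h₁~h₂))

  midpointˡ : ∀ {g h} → Midpoint G g → Midpoint (G ⊠ H) (g , h)
  midpointˡ (_ , _ , x~g , g~z , x#z) = _ , _ , adjˡ x~g , adjˡ g~z , apartˡ x#z

  midpointʳ : ∀ {g h} → Midpoint H h → Midpoint (G ⊠ H) (g , h)
  midpointʳ (_ , _ , x~h , h~z , x#z) = _ , _ , adjʳ x~h , adjʳ h~z , apartʳ x#z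

  -- After `(g₁ , h)` all first coordinates on the walk are `g`, apart from `g₂`; before `(g , h₁)`
  -- all second coordinates are `h`, apart from `h₂`. This gives every non-adjacency that the toll
  -- conditions demand.
  ends⇒¬extreme : ∀ {g h} → End G g → End H h → ¬ Extreme (G ⊠ H) (g , h)
  ends⇒¬extreme {g} {h} (g₁ , g₂ , g~g₁ , g₁~g₂ , g#g₂) (h₁ , h₂ , h~h₁ , h₁~h₂ , h#h₂) ext =
    ext (proj₁ (apartˡ g#g₂)) (proj₁ (apartʳ h#h₂))
      (_ , walk w (proj₁ (apartˡ g₂#g)) (proj₂ (apartˡ g₂#g)) steps fromStart fromEnd
         , there (there (here refl)))
      refl
    where
    g₂#g = Apart-sym G g#g₂
    h₂#h = Apart-sym H h#h₂

    w : Vector (V (G ⊠ H)) 3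
    w = (g₁ , h) ∷ (g , h) ∷ (g , h₁) ∷ []

    steps = λ where
      zero       → adjˡ (adj-sym G g~g₁)
      (suc zero) → adjʳ h~h₁

    fromStart = λ where
      zero             → mk⇔ (λ _ → refl) (λ _ → adjˡ (adj-sym G g₁~g₂))
      (suc zero)       → mk⇔ (λ a → contradiction a (proj₂ (apartˡ g₂#g))) λ ()
      (suc (suc zero)) → mk⇔ (λ a → contradiction a (proj₂ (apartˡ g₂#g))) λ ()

    fromEnd = λ where
      zero             → mk⇔ (λ a → contradiction a (proj₂ (apartʳ h₂#h))) λ ()
      (suc zero)       → mk⇔ (λ a → contradiction a (proj₂ (apartʳ h₂#h))) λ ()
      (suc (suc zero)) → mk⇔ (λ _ → refl) (λ _ → adjʳ (adj-sym H h₁~h₂))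

theorem3p10 : (G H : Graph) →
    Finite G → Connected G → ¬ Complete G →
    Finite H → Connected H → ¬ Complete H →
    ¬ (∃[ s ] Extreme (G ⊠ H) s)
theorem3p10 G H finG connG ¬compG finH connH ¬compH ((g , h) , ext) =
  -- The goal is `⊥`, so the double-negated dichotomy can be used as an ordinary case split.
  ¬¬-midpoint⊎end G finG connG ¬compG g λ where
    (inj₁ mid)  → midpoint⇒¬extreme (G ⊠ H) (midpointˡ G H mid) ext
    (inj₂ endG) → ¬¬-midpoint⊎end H finH connH ¬compH h λ where
      (inj₁ mid)  → midpoint⇒¬extreme (G ⊠ H) (midpointʳ G H mid) ext
      (inj₂ endH) → ends⇒¬extreme G H endG endH ext
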